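{- Let $y$ be a Lyndon word of length $n>1$ over a totally ordered alphabet. Run Algorithm LeftLyndonTree (described in the context) on $y$. Then the algorithm creates exactly the $n-1$ internal nodes of the left Lyndon tree $\mathrm{LLT}(y)$, and the order in which it creates them is the order of their associated prefixes under the infinite ordering $\prec$: if node $q$ is created before node $q'$, then the prefix associated with $q$ is $\prec$-smaller than the prefix associated with $q'$. Equivalently, listing the internal nodes in creation order lists the proper non-empty prefixes of $y$ in strictly $\prec$-increasing order.
   Context: Words are finite sequences $y=y[0]y[1]\cdots y[n-1]$ over a totally ordered alphabet. $y[i\,..\,j]$ denotes the factor $y[i]\cdots y[j]$. Lexicographic order $<$: $u<v$ if $u$ is a proper prefix of $v$, or $u=ras$, $v=rbt$ for words $r,s,t$ and letters $a<b$. Lyndon word: a non-empty word $w$ such that $w<v$ for every proper non-empty suffix $v$ of $w$. Infinite ordering: $u^\infty$ is the infinite word $uuu\cdots$, compared lexicographically. For non-empty words $u,v$, $u\prec v$ iff $u^\infty<v^\infty$, or $u^\infty=v^\infty$ and $|u|>|v|$. Left Lyndon tree $\mathrm{LLT}(y)$ of a Lyndon word $y$: if $|y|=1$ it is a single leaf; otherwise write $y=uv$ where $u$ is the longest proper prefix of $y$ that is a Lyndon word (then $v$ is a Lyndon word), and $\mathrm{LLT}(y)$ is a root whose left subtree is $\mathrm{LLT}(u)$ and right subtree is $\mathrm{LLT}(v)$. The leaves, read left to right, are identified with the positions $0,1,\dots,n-1$ of $y$. Each internal node spans a factor $y[s\,..\,t]$ whose left child spans $y[s\,..\,m]$ for some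 $m$ with $s\le m<t$; the prefix associated with this internal node is $y[0\,..\,m]$. This gives a bijection between internal nodes and proper non-empty prefixes of $y$. Algorithm LeftLyndonTree (input: Lyndon word $y$ of length $n$; arrays lyns, root indexed by positions; internal nodes are fresh identifiers $\ge n$ with left and right child pointers): lyns[0] ← 1; root[0] ← 0; per ← 1; i ← 0. For j = 1 to n−1: root[j] ← j; if y[j] ≠ y[i] then { lyns[j] ← j+1; per ← j+1; i ← 0 } else { lyns[j] ← lyns[i]; i ← (i+1) mod per }; ℓ ← 1; k ← j−1; while ℓ < lyns[j]: { create a new internal node q with left child root[k] and right child root[j]; root[j] ← q; ℓ ← ℓ + lyns[k]; k ← k − lyns[k] }. Return root[n−1] (the root of the constructed binary tree). -}

module Defs where

open import Data.Bool.Base using (if_then_else_)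
open import Data.Fin.Base using (fromℕ<)
open import Data.Integer.Base using (ℤ; +_; _⊖_)
open import Data.List.Base
  using (List; []; _∷_; [_]; _++_; length; lookup; map; take; upTo)
open import Data.List.Membership.Propositional using (_∈_)
open import Data.List.Relation.Binary.Lex.Strict using (Lex-<)
open import Data.Nat.Base using (ℕ; suc; _+_; _∸_; _≤_; _<_; _>_; NonZero)
open import Data.Nat.DivMod using (_%_; _mod_)
open import Data.Nat.Properties using (_≟_)
open import Data.Product.Base using (∃; _×_)
open import Data.Tree.Binary using (Tree; leaf; node)
open import Level using (_⊔_)
open import Relation.Binary.Bundles using (StrictTotalOrder)
open import Relation.Binary.Core using (Rel)
open import Relation.Binary.PropositionalEquality.Core using (_≡_; _≢_)
open import Relation.Nullary.Decidable.Core using (does)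
open import Relation.Nullary.Negation.Core using (¬_)

Array : Set
Array = ℕ → ℕ

_[_≔_] : Array → ℕ → ℕ → Array
(f [ k ≔ v ]) m = if does (m ≟ k) then v else f m

-- An internal node of the pointer structure.  In a run on a word of length n,
-- an identifier p < n denotes the leaf at position p.
record Node : Set where
  constructor mkNode
  field
    ident left right : ℕ

record State : Set where
  field
    lyns root : Array
    per i     : ℕ
    nodes     : List Node   -- in creation order

open State public

created : State → List ℕ
created σ = map Node.ident (nodes σ)

-- Unfolds n h q t : following the pointers in h from q yields the tree t, whose
-- internal nodes carry their identifiers and whose leaves carry positions.
data Unfolds (n : ℕ) (h : List Node) : ℕ → Tree ℕ ℕ → Set where
  leaf : ∀ {p} → p < n → Unfolds n h p (leaf p)
  node : ∀ {q l r L R} → mkNode q l r ∈ h →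
         Unfolds n h l L → Unfolds n h r R → Unfolds n h q (node L q R)

rightmostLeaf : Tree ℕ ℕ → ℕ
rightmostLeaf (leaf p)     = p
rightmostLeaf (node _ _ R) = rightmostLeaf R

-- SplitsAt t q m : t has an internal node labelled q whose left subtree spans
-- positions s, …, m for some s.
data SplitsAt : Tree ℕ ℕ → ℕ → ℕ → Set where
  here    : ∀ {L q R} → SplitsAt (node L q R) q (rightmostLeaf L)
  inLeft  : ∀ {L x R q m} → SplitsAt L q m → SplitsAt (node L x R) q m
  inRight : ∀ {L x R q m} → SplitsAt R q m → SplitsAt (node L x R) q m

module LyndonTrees {c ℓ₁ ℓ₂} (alphabet : StrictTotalOrder c ℓ₁ ℓ₂) where

  open StrictTotalOrder alphabet public
    using (_≈_; _≉_)
    renaming (Carrier to Letter; _<_ to _<ᴬ_)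

  Word : Set c
  Word = List Letter

  infix 4 _<ˡᵉˣ_ _<∞_ _≈∞_ _≺_

  _<ˡᵉˣ_ : Rel Word (c ⊔ ℓ₁ ⊔ ℓ₂)
  _<ˡᵉˣ_ = Lex-< _≈_ _<ᴬ_

  Lyndon : Word → Set (c ⊔ ℓ₁ ⊔ ℓ₂)
  Lyndon w = w ≢ [] × (∀ u v → u ≢ [] → v ≢ [] → w ≡ u ++ v → w <ˡᵉˣ v)

  _^∞ : (u : Word) .{{_ : NonZero (length u)}} → ℕ → Letter
  (u ^∞) k = lookup u (k mod length u)

  _≈∞_ : Rel (ℕ → Letter) ℓ₁
  s ≈∞ t = ∀ k → s k ≈ t k

  _<∞_ : Rel (ℕ → Letter) (ℓ₁ ⊔ ℓ₂)
  s <∞ t = ∃ λ k → (∀ m → m < k → s m ≈ t m) × s k <ᴬ t k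

  -- Defined on non-empty words only, hence the shape of the indices.
  data _≺_ : Rel Word (c ⊔ ℓ₁ ⊔ ℓ₂) where
    less   : ∀ {a u b v} → (a ∷ u) ^∞ <∞ (b ∷ v) ^∞ → a ∷ u ≺ b ∷ v
    longer : ∀ {a u b v} → (a ∷ u) ^∞ ≈∞ (b ∷ v) ^∞ →
             length (a ∷ u) > length (b ∷ v) → a ∷ u ≺ b ∷ v

  prefixUpTo : Word → ℕ → Word
  prefixUpTo y m = take (suc m) y

  properPrefixes : Word → List Word
  properPrefixes y = map (prefixUpTo y) (upTo (length y ∸ 1))

  -- LongestLyndonPrefix u v : u is the longest proper prefix of u ++ v that is
  -- a Lyndon word.
  LongestLyndonPrefix : Word → Word → Set (c ⊔ ℓ₁ ⊔ ℓ₂)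
  LongestLyndonPrefix u v =
    Lyndon u × v ≢ [] ×
    (∀ u′ v′ → v′ ≢ [] → u ++ v ≡ u′ ++ v′ → Lyndon u′ → length u′ ≤ length u)

  -- IsLLT s y t : t is the left Lyndon tree of y, where y occupies the positions
  -- s, s + 1, … .  The labels of internal nodes are unconstrained.
  data IsLLT : ℕ → Word → Tree ℕ ℕ → Set (c ⊔ ℓ₁ ⊔ ℓ₂) where
    leaf : ∀ {s a} → IsLLT s [ a ] (leaf s)
    node : ∀ {s y u v L q R} → y ≡ u ++ v → LongestLyndonPrefix u v →
           IsLLT s u L → IsLLT (s + length u) v R → IsLLT s y (node L q R)

  AssociatedPrefix : Word → Tree ℕ ℕ → ℕ → Word → Set c
  AssociatedPrefix y t q p = ∃ λ m → SplitsAt t q m × p ≡ prefixUpTo y m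

  -- The algorithm, as a big-step semantics.
  module _ (y : Word) where

    private
      n : ℕ
      n = length y

    letterAt : ∀ j → .(j < n) → Letter
    letterAt j j<n = lookup y (fromℕ< j<n)

    -- The arrays passed in stand for the uninitialised memory.
    initial : Array → Array → State
    initial lyns₀ root₀ = record
      { lyns  = lyns₀ [ 0 ≔ 1 ]
      ; root  = root₀ [ 0 ≔ 0 ]
      ; per   = 1
      ; i     = 0
      ; nodes = []
      }

    data Conditional (j : ℕ) (σ : State) : State → Set ℓ₁ where
      then-branch : (j<n : j < n) (i<n : i σ < n) →
        letterAt j j<n ≉ letterAt (i σ) i<n →
        Conditional j σ
          record σ { lyns = lyns σ [ j ≔ suc j ] ; per = suc j ; i = 0 }
      else-branch : .{{_ : NonZero (per σ)}} (j<n : j < n) (i<n : i σ < n) →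
        letterAt j j<n ≈ letterAt (i σ) i<n →
        Conditional j σ
          record σ { lyns = lyns σ [ j ≔ lyns σ (i σ) ] ; i = suc (i σ) % per σ }

    -- Identifiers n, n + 1, … are allocated consecutively.
    createNode : ℕ → ℕ → State → State
    createNode j k σ = record σ
      { root  = root σ [ j ≔ q ]
      ; nodes = nodes σ ++ [ mkNode q (root σ k) (root σ j) ]
      }
      where
      q : ℕ
      q = n + length (nodes σ)

    -- The indices after j are the variables ℓ and k of the while loop.  At the
    -- exit k may be -1; an iteration with negative k would be stuck.
    data While (j : ℕ) : ℕ → ℤ → State → State → Set where
      exit    : ∀ {ℓ k σ} → ¬ (ℓ < lyns σ j) → While j ℓ k σ σ
      iterate : ∀ {ℓ k σ τ} → ℓ < lyns σ j →
        While j (ℓ + lyns σ k) (k ⊖ lyns σ k) (createNode j k σ) τ →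
        While j ℓ (+ k) σ τ

    data For : ℕ → State → State → Set ℓ₁ where
      exit    : ∀ {j σ} → ¬ (j < n) → For j σ σ
      iterate : ∀ {j σ σ₁ σ₂ τ} → j < n →
        Conditional j record σ { root = root σ [ j ≔ j ] } σ₁ →
        While j 1 (j ⊖ 1) σ₁ σ₂ →
        For (suc j) σ₂ τ →
        For j σ τ

    Run : Array → Array → State → Set ℓ₁
    Run lyns₀ root₀ = For 1 (initial lyns₀ root₀)

    returned : State → ℕ
    returned σ = root σ (n ∸ 1)

{-# OPTIONS --safe #-}
-- Say that the suffix at s agrees up to e when y[s .. e−1] is a prefix of y.  Because y is
-- Lyndon, each suffix at s > 0 agrees up to some e < n, and there y[e] > y[e−s].  The longest
-- Lyndon suffix of y[0 .. j] starts at its shortest border, i.e. at the largest a whose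
-- suffix agrees up to j+1.  The trees merged in round j start at positions s that agree up to
-- j; as long as s > a the agreement ends exactly at j, so y[0 .. s−1]^∞ first falls below y
-- at position j.  Hence prefixes whose nodes are created in different rounds compare as the
-- rounds do.  Within one round s decreases, and two periods of y[0 .. j−1] are compared via
-- their remainder.
module Submission where

import Algebra.Properties.CommutativeSemigroup as CommutativeSemigroup
open import Data.Empty using (⊥-elim)
open import Data.Fin.Base using (Fin; zero; suc; toℕ; fromℕ<) renaming (_<_ to _<ᶠ_)
open import Data.Fin.Properties using (toℕ-fromℕ<)
open import Data.Integer.Base using (_⊖_)
open import Data.Integer.Properties using (+-cancelˡ-⊖)
open import Data.List.Base
  using (List; []; _∷_; [_]; _++_; length; lookup; take; drop; map; upTo)
open import Data.List.Membership.Propositional using (_∈_)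
open import Data.List.Membership.Propositional.Properties
  using (∈-++⁺ˡ; ∈-++⁺ʳ; ∈-++⁻; ∈-map⁺; ∈-map⁻; ∈-upTo⁺; ∈-upTo⁻; ∈-lookup)
open import Data.List.Membership.Propositional.Properties.WithK using (unique∧set⇒bag)
open import Data.List.Properties
  using (++-assoc; drop-drop; length-++; length-drop; length-map; length-take; length-upTo;
         map-++; map-∘; take++drop≡id; take-all)
open import Data.List.Relation.Binary.BagAndSetEquality using (∼bag⇒↭)
open import Data.List.Relation.Binary.Lex.Core using (this; next)
open import Data.List.Relation.Binary.Permutation.Propositional using (_↭_)
open import Data.List.Relation.Binary.Permutation.Propositional.Properties
  using (↭-length) renaming (map⁺ to ↭-map⁺)
open import Data.List.Relation.Binary.Pointwise.Base using (Pointwise; []; _∷_)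
open import Data.List.Relation.Unary.All as All using (All; []; _∷_)
import Data.List.Relation.Unary.All.Properties as All
open import Data.List.Relation.Unary.AllPairs.Core using (AllPairs; []; _∷_)
import Data.List.Relation.Unary.AllPairs.Properties as AllPairs
open import Data.List.Relation.Unary.Any using (here; there)
open import Data.List.Relation.Unary.Unique.Propositional using (Unique)
open import Data.List.Relation.Unary.Unique.Propositional.Properties using (upTo⁺)
open import Data.Nat.Base hiding (_⊔_)
open import Data.Nat.DivMod
open import Data.Nat.Induction using (<-wellFounded)
open import Data.Nat.Properties
open import Data.Product.Base using (∃; ∃₂; _×_; _,_; proj₁; proj₂)
open import Data.Sum.Base using (_⊎_; inj₁; inj₂)
open import Data.Tree.Binary using (Tree; leaf; node; module Infix)
open import Function.Bundles using (mk⇔)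
open import Induction.WellFounded using (Acc; acc)
open import Level using (_⊔_)
open import Relation.Binary.Bundles using (StrictTotalOrder)
open import Relation.Binary.Definitions using (tri<; tri≈; tri>)
open import Relation.Binary.PropositionalEquality.Core
  using (_≡_; _≢_; refl; sym; trans; cong; cong₂; subst; subst₂)
open import Relation.Nullary.Decidable using (dec-true; dec-false)
open import Relation.Nullary.Decidable.Core using (Dec; yes; no)
open import Relation.Nullary.Negation.Core using (¬_)
open import Defs

open CommutativeSemigroup +-commutativeSemigroup using (x∙yz≈y∙xz)

-- Lyndon words as sequences of letters

-- The order of creation cannot be read off the trees: while the loops run, the trees under the
-- various `root` entries share subtrees, and `IsLLT` says nothing about labels. The proof therefore
-- carries a ghost log with the split and the round of every node. The log is kept sorted along the
-- loops and is matched with the tree only at the end. No split is logged twice, since the agreement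
-- of the suffix after it ends at one position only. The array `lyns` is governed by the smallest
-- period p of y[0 .. j-1]. The index i is j mod p, so comparing y[j] with y[i] tests whether p
-- survives. If it does, y[0 .. i] recurs at the last multiple of p and carries its shortest border
-- along, so `lyns[i]` may be copied; if not, y[0 .. j] is unbordered. Letters are equal only up to
-- `≈`, so borders are stated letter by letter on numeric positions, and words appear only where the
-- definitions demand them. The claim concerns every run: one run is constructed together with its
-- invariant, and determinism transfers the result.

module LyndonSequence {c ℓ₁ ℓ₂} (alphabet : StrictTotalOrder c ℓ₁ ℓ₂)
  (Y : ℕ → StrictTotalOrder.Carrier alphabet) where

  open LyndonTrees alphabet
  private
    module A = StrictTotalOrder alphabet
    module ≈ = A.Eq

  Agree : ℕ → ℕ → Set ℓ₁
  Agree s e = ∀ t → s + t < e → Y (s + t) ≈ Y t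

  -- a is where the shortest border of Y 0 … Y j starts, or 0 if there is none;
  -- the longest Lyndon suffix of Y 0 … Y j also starts there.
  ShortestBorder : ℕ → ℕ → Set ℓ₁
  ShortestBorder a j =
    a ≤ j × Agree a (suc j) × (∀ s → a < s → s ≤ j → ¬ Agree s (suc j))

  FirstExcess : ℕ → ℕ → Set (ℓ₁ ⊔ ℓ₂)
  FirstExcess r t = (∀ s → s < t → Y (r + s) ≈ Y s) × Y t <ᴬ Y (r + t)

  Y≈ : ∀ {i j} → i ≡ j → Y i ≈ Y j
  Y≈ eq = ≈.reflexive (cong Y eq)

  agree-mono : ∀ {s e e′} → e ≤ e′ → Agree s e′ → Agree s e
  agree-mono e≤e′ ag t lt = ag t (<-≤-trans lt e≤e′)

  agree-below : ∀ {s t} → (∀ z → z < t → Y (s + z) ≈ Y z) → Agree s (s + t)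
  agree-below {s} h z lt = h z (+-cancelˡ-< s _ _ lt)

  agree-periodic : ∀ {p j} → Agree p j → ∀ e t → t + e * p < j → Y (t + e * p) ≈ Y t
  agree-periodic ag zero t lt = Y≈ (+-identityʳ t)
  agree-periodic {p} {j} ag (suc e) t lt =
    ≈.trans (Y≈ eq) (≈.trans (ag (t + e * p) lt′)
      (agree-periodic ag e t (≤-<-trans (m≤n+m _ p) lt′)))
    where
    eq : t + (p + e * p) ≡ p + (t + e * p)
    eq = x∙yz≈y∙xz t p (e * p)
    lt′ : p + (t + e * p) < j
    lt′ = subst (_< j) eq lt

  -- The agreement makes `suc m` a period, so the infinite power of the prefix of that length copies
  -- the word up to `j`. Powers are compared with one another through the word in this way.
  agree-% : ∀ {m j} → Agree (suc m) j → ∀ k → k < j → Y (k % suc m) ≈ Y k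
  agree-% {m} {j} ag k k<j =
    ≈.sym (≈.trans (Y≈ eq) (agree-periodic ag (k / suc m) (k % suc m) (subst (_< j) eq k<j)))
    where eq = m≡m%n+[m/n]*n k (suc m)

  -- Only starts beyond `d + a` have to be excluded, and they all lie in the copy of Y 0 ... Y i at
  -- `d`. This justifies copying `lyns[i]` in the else branch.
  shortestBorder-shift : ∀ {a i d} → ShortestBorder a i → Agree d (suc (d + i)) →
    ShortestBorder (d + a) (d + i)
  shortestBorder-shift {a} {i} {d} (a≤i , ag , max) bd =
    +-monoʳ-≤ d a≤i , ag′ , max′
    where
    unshift : ∀ {s t} → (d + s) + t < suc (d + i) → s + t < suc i
    unshift {s} {t} lt =
      s≤s (+-cancelˡ-≤ d _ _ (subst (_≤ d + i) (+-assoc d s t) (≤-pred lt)))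
    shifted : ∀ s t → s + t < suc i → Y ((d + s) + t) ≈ Y (s + t)
    shifted s t lt =
      ≈.trans (Y≈ (+-assoc d s t)) (bd (s + t) (s≤s (+-monoʳ-≤ d (≤-pred lt))))
    ag′ : Agree (d + a) (suc (d + i))
    ag′ t lt = ≈.trans (shifted a t (unshift {a} lt)) (ag t (unshift {a} lt))
    max′ : ∀ s → d + a < s → s ≤ d + i → ¬ Agree s (suc (d + i))
    max′ s lt le ags with m≤n⇒∃[o]m+o≡n (≤-trans (m≤m+n d a) (<⇒≤ lt))
    ... | s′ , refl = max s′ (+-cancelˡ-< d _ _ lt) (+-cancelˡ-≤ d _ _ le) λ t lt′ →
      ≈.trans (≈.sym (shifted s′ t lt′))
        (ags t (s≤s (subst (_≤ d + i) (sym (+-assoc d s′ t)) (+-monoʳ-≤ d (≤-pred lt′)))))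

  module Lyndonian (n : ℕ)
    (excess : ∀ r → 0 < r → r < n → ∃ λ t → r + t < n × FirstExcess r t) where

    ¬below : ∀ a t → a + t < n → (∀ s → s < t → Y (a + s) ≈ Y s) → ¬ Y (a + t) <ᴬ Y t
    ¬below zero t _ _ lt = A.irrefl ≈.refl lt
    ¬below a@(suc _) t lt h below with excess a z<s (≤-<-trans (m≤m+n a t) lt)
    ... | t₀ , _ , h₀ , above with <-cmp t t₀
    ... | tri< t<t₀ _ _ = A.irrefl (h₀ t t<t₀) below
    ... | tri≈ _ refl _ = A.asym below above
    ... | tri> _ _ t₀<t = A.irrefl (≈.sym (h t₀ t₀<t)) above

    agree-end⇒excess : ∀ s t → 0 < s → s + t < n →
      Agree s (s + t) → ¬ Agree s (suc (s + t)) → Y t <ᴬ Y (s + t)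
    agree-end⇒excess s t 0<s lt ag ¬ag with excess s 0<s (≤-<-trans (m≤m+n s t) lt)
    ... | t₀ , _ , h₀ , above with <-cmp t t₀
    ... | tri< t<t₀ _ _ = ⊥-elim (¬ag λ z z<t →
      h₀ z (≤-<-trans (+-cancelˡ-≤ s _ _ (≤-pred z<t)) t<t₀))
    ... | tri≈ _ refl _ = above
    ... | tri> _ _ t₀<t = ⊥-elim (A.irrefl (≈.sym (ag t₀ (+-monoʳ-< s t₀<t))) above)

    -- A Lyndon word is unbordered. After the last round this forces the tree under `root[n−1]` to
    -- start at 0.
    agree-full⇒zero : ∀ a → a < n → Agree a n → a ≡ 0
    agree-full⇒zero zero _ _ = refl
    agree-full⇒zero a@(suc _) a<n ag with excess a z<s a<n
    ... | t , lt , _ , above = ⊥-elim (A.irrefl (≈.sym (ag t lt)) above)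

    -- If the agreement from a broke at a position of the range where s = a + d
    -- still agrees, then the suffix at d would be smaller than the word.
    agree-extend : ∀ a d j → j ≤ n → Agree a (a + d) → Agree (a + d) j → Agree a j
    agree-extend zero d j _ _ _ t _ = ≈.refl
    agree-extend a@(suc _) d j j≤n ag₁ ag₂ t t<j
      with excess a z<s (≤-<-trans (m≤m+n a t) (<-≤-trans t<j j≤n))
    ... | t₀ , _ , h₀ , above with t <? t₀
    ... | yes t<t₀ = h₀ t t<t₀
    ... | no t≮t₀ with m≤n⇒∃[o]m+o≡n d≤t₀
      where
      d≤t₀ : d ≤ t₀
      d≤t₀ = ≮⇒≥ λ t₀<d → A.irrefl (≈.sym (ag₁ t₀ (+-monoʳ-< a t₀<d))) above
    ... | x , refl = ⊥-elim (¬below d x (≤-<-trans (m≤n+m _ a) (<-≤-trans hi j≤n)) eqs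
        (A.<-respʳ-≈ (≈.trans (Y≈ (sym (+-assoc a d x))) (ag₂ x (reassoc x hi))) above))
      where
      reassoc : ∀ z → a + (d + z) < j → (a + d) + z < j
      reassoc z = subst (_< j) (sym (+-assoc a d z))
      hi : a + (d + x) < j
      hi = ≤-<-trans (+-monoʳ-≤ a (≮⇒≥ t≮t₀)) t<j
      eqs : ∀ z → z < x → Y (d + z) ≈ Y z
      eqs z z<x = ≈.trans (≈.sym (h₀ (d + z) (+-monoʳ-< d z<x)))
        (≈.trans (Y≈ (sym (+-assoc a d z)))
          (ag₂ z (reassoc z (<-trans (+-monoʳ-< a (+-monoʳ-< d z<x)) hi))))

    -- A border starting at s = p + d would make the suffix at d smaller than the word.
    mismatch⇒unbordered : ∀ p x → 0 < p → p + x < n → Agree p (p + x) → Y (p + x) ≉ Y x →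
      (∀ s → 0 < s → s < p → ¬ Agree s p) →
      ∀ s → 0 < s → s ≤ p + x → ¬ Agree s (suc (p + x))
    mismatch⇒unbordered p x 0<p px<n agp mis unb s 0<s s≤ ags with s <? p
    ... | yes s<p = unb s 0<s s<p (agree-mono (≤-trans (m≤m+n p x) (n≤1+n _)) ags)
    ... | no s≮p with m≤n⇒∃[o]m+o≡n (≮⇒≥ s≮p)
    ... | d , refl with m≤n⇒∃[o]m+o≡n (+-cancelˡ-≤ p _ _ s≤)
    ... | t , refl = ¬below d t (≤-<-trans (m≤n+m _ p) px<n)
      (λ z z<t → ≈.trans (≈.sym (agp (d + z) (+-monoʳ-< p (+-monoʳ-< d z<t))))
        (shifted z (<⇒≤ z<t)))
      (A.<-respʳ-≈ (shifted t ≤-refl)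
        (agree-end⇒excess p (d + t) 0<p px<n agp λ ag → mis (ag (d + t) ≤-refl)))
      where
      shifted : ∀ z → z ≤ t → Y (p + (d + z)) ≈ Y z
      shifted z z≤t = ≈.trans (Y≈ (sym (+-assoc p d z))) (ags z (s≤s
        (subst (_≤ p + (d + t)) (sym (+-assoc p d z)) (+-monoʳ-≤ p (+-monoʳ-≤ d z≤t)))))

    -- Within the border, the suffix at `a` reads as the word, so an excess over the word is an
    -- excess over the border. It occurs by position `k`, as otherwise `a + r` would start a shorter
    -- border.
    shortestBorder⇒excess : ∀ a k → k < n → ShortestBorder a k → ∀ r → 0 < r → a + r ≤ k →
      ∃ λ t → (a + r) + t ≤ k × (∀ z → z < t → Y (a + z) ≈ Y ((a + r) + z))
        × Y (a + t) <ᴬ Y ((a + r) + t)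
    shortestBorder⇒excess a k k<n (_ , ag , max) r 0<r ar≤k
      with excess (a + r) (<-≤-trans 0<r (m≤n+m r a)) (≤-<-trans ar≤k k<n)
    ... | t , _ , h , above = t , in-range , eqs , A.<-respˡ-≈ (≈.sym (border t ≤-refl)) above
      where
      in-range : (a + r) + t ≤ k
      in-range = ≮⇒≥ λ k<art → max (a + r) (m<m+n a 0<r) ar≤k
        (agree-mono k<art (agree-below h))
      border : ∀ z → z ≤ t → Y (a + z) ≈ Y z
      border z z≤t = ag z (s≤s (≤-trans (+-monoˡ-≤ z (m≤m+n a r))
        (≤-trans (+-monoʳ-≤ (a + r) z≤t) in-range)))
      eqs : ∀ z → z < t → Y (a + z) ≈ Y ((a + r) + z)
      eqs z z<t = ≈.trans (border z (<⇒≤ z<t)) (≈.sym (h z z<t))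

    agree⇒¬excess : ∀ a s j → a ≤ s → j ≤ n → Agree s j → ∀ t → s + t < j →
      (∀ z → z < t → Y (a + z) ≈ Y (s + z)) → ¬ Y (a + t) <ᴬ Y (s + t)
    agree⇒¬excess a s j a≤s j≤n ag t st<j eqs above =
      ¬below a t (≤-<-trans (+-monoˡ-≤ t a≤s) (<-≤-trans st<j j≤n))
        (λ z z<t → ≈.trans (eqs z z<t) (ag z (<-trans (+-monoʳ-< s z<t) st<j)))
        (A.<-respʳ-≈ (ag t st<j) above)

    -- m is the last position of a prefix; j is the first position where the
    -- prefix, repeated, falls below the word.
    Breaks : ℕ → ℕ → Set ℓ₁
    Breaks m j = m < j × j < n × Agree (suc m) j × ¬ Agree (suc m) (suc j)

    repeat : ℕ → ℕ → Letter
    repeat m k = Y (k % suc m)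

    repeat-at-break : ∀ m j → Breaks m j → repeat m j <ᴬ Y j
    repeat-at-break m j (m<j , j<n , ag , ¬ag) with m≤n⇒∃[o]m+o≡n m<j
    -- Here j is `suc m + x`, and `x` may exceed one period; the agreement still lets the repetition
    -- read Y x at j.
    ... | x , refl = A.<-respˡ-≈ (≈.sym (≈.trans (Y≈ ([n+m]%n≡m%n))
            (agree-% ag x (s≤s (m≤n+m x m)))))
          (agree-end⇒excess (suc m) x z<s j<n ag ¬ag)
      where
      [n+m]%n≡m%n : (suc m + x) % suc m ≡ x % suc m
      [n+m]%n≡m%n = trans (cong (_% suc m) (+-comm (suc m) x)) ([m+n]%n≡m%n x (suc m))

    repeat-order-< : ∀ {m m′ j j′} → Breaks m j → Breaks m′ j′ → j < j′ → repeat m <∞ repeat m′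
    repeat-order-< {m} {m′} {j} {j′} b@(_ , _ , ag , _) (_ , _ , ag′ , _) j<j′ =
      j , (λ k k<j → ≈.trans (agree-% ag k k<j) (≈.sym (agree-% ag′ k (<-trans k<j j<j′))))
        , A.<-respʳ-≈ (≈.sym (agree-% ag′ j j<j′)) (repeat-at-break m j b)

    -- Write p = suc m, p′ = suc m′ and r = p % p′.  Past position p, the two repetitions
    -- compare as Y compares with its suffix at r.  If these first differ at some t < p′
    -- then the suffix is larger; otherwise the repetition of period p′ also has period p.
    repeat-order-≡ : ∀ {m m′ j} → Breaks m j → Breaks m′ j → m′ < m →
      repeat m <∞ repeat m′ ⊎ repeat m ≈∞ repeat m′
    repeat-order-≡ {m} {m′} {j} (m<j , j<n , ag , _) (_ , _ , ag′ , _) m′<m = by-remainder r refl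
      where
      p = suc m
      p′ = suc m′
      r = p % p′

      -- The window of length p′ at r lies below p and hence below j, where both repetitions still
      -- copy the word.
      r+p′≤p : r + p′ ≤ p
      r+p′≤p = subst (r + p′ ≤_) (sym (m≡m%n+[m/n]*n p p′))
        (+-monoʳ-≤ r (m≤n*m p′ (p / p′) {{>-nonZero (m≥n⇒m/n>0 (<⇒≤ (s<s m′<m)))}}))

      shift-r : ∀ t → repeat m′ (p + t) ≈ repeat m′ (r + t)
      shift-r t = Y≈ (trans (%-distribˡ-+ p t p′) (trans
        (cong (λ z → (z + t % p′) % p′) (sym (m%n%n≡m%n p p′))) (sym (%-distribˡ-+ r t p′))))

      case-excess : ∀ t → t < p′ → (∀ s → s < t → Y (r + s) ≈ Y s) → Y t <ᴬ Y (r + t) →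
        repeat m <∞ repeat m′
      case-excess t t<p′ eqs above = p + t , before , at
        where
        rt<j : ∀ s → s ≤ t → r + s < j
        rt<j s s≤t = <-≤-trans (+-monoʳ-< r (≤-<-trans s≤t t<p′)) (≤-trans r+p′≤p m<j)
        t<j : ∀ s → s ≤ t → s < j
        t<j s s≤t = ≤-<-trans (m≤n+m s r) (rt<j s s≤t)
        left : ∀ s → s ≤ t → repeat m (p + s) ≈ Y s
        left s s≤t = ≈.trans (Y≈ (trans (cong (_% p) (+-comm p s)) ([m+n]%n≡m%n s p)))
          (agree-% ag s (t<j s s≤t))
        right : ∀ s → s ≤ t → repeat m′ (p + s) ≈ Y (r + s)
        right s s≤t = ≈.trans (shift-r s) (agree-% ag′ (r + s) (rt<j s s≤t))
        at : repeat m (p + t) <ᴬ repeat m′ (p + t)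
        at = A.<-respʳ-≈ (≈.sym (right t ≤-refl)) (A.<-respˡ-≈ (≈.sym (left t ≤-refl)) above)
        before : ∀ k → k < p + t → repeat m k ≈ repeat m′ k
        before k k<pt with k <? p
        ... | yes k<p = ≈.trans (agree-% ag k (<-≤-trans k<p m<j))
                          (≈.sym (agree-% ag′ k (<-≤-trans k<p m<j)))
        ... | no k≮p with m≤n⇒∃[o]m+o≡n (≮⇒≥ k≮p)
        ... | s , refl = ≈.trans (left s (<⇒≤ s<t))
                (≈.trans (≈.sym (eqs s s<t)) (≈.sym (right s (<⇒≤ s<t))))
          where s<t = +-cancelˡ-< p _ _ k<pt

      case-equal : (∀ t → t < p′ → Y (r + t) ≈ Y t) → repeat m ≈∞ repeat m′
      case-equal eqs k = ≈.sym (≈.trans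
        (Y≈ (cong (_% p′) (m≡m%n+[m/n]*n k p)))
        (≈.trans (shift-p (k / p) (k % p))
          (agree-% ag′ (k % p) (<-≤-trans (m%n<n k p) m<j))))
        where
        shift : ∀ t → repeat m′ (p + t) ≈ repeat m′ t
        shift t = ≈.trans (shift-r t) (≈.trans
          (Y≈ (trans (%-distribˡ-+ r t p′) (trans
            (cong (λ z → (r % p′ + z) % p′) (sym (m%n%n≡m%n t p′)))
            (sym (%-distribˡ-+ r (t % p′) p′)))))
          (≈.trans (agree-% ag′ (r + t % p′)
            (<-≤-trans (+-monoʳ-< r (m%n<n t p′)) (≤-trans r+p′≤p m<j)))
            (eqs (t % p′) (m%n<n t p′))))
        shift-p : ∀ e t → repeat m′ (t + e * p) ≈ repeat m′ t
        shift-p zero t = Y≈ (cong (_% p′) (+-identityʳ t))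
        shift-p (suc e) t = ≈.trans (Y≈ (cong (_% p′) (x∙yz≈y∙xz t p (e * p))))
          (≈.trans (shift (t + e * p)) (shift-p e t))

      by-remainder : ∀ r′ → r′ ≡ r → repeat m <∞ repeat m′ ⊎ repeat m ≈∞ repeat m′
      by-remainder zero eq = inj₂ (case-equal λ t _ → Y≈ (cong (_+ t) (sym eq)))
      by-remainder r′@(suc _) eq
        with excess r (subst (0 <_) eq z<s)
               (<-≤-trans (m%n<n p p′) (≤-trans (<⇒≤ (s<s m′<m)) (≤-trans m<j (<⇒≤ j<n))))
      ... | t , _ , eqs , above with t <? p′
      ... | yes t<p′ = inj₁ (case-excess t t<p′ eqs above)
      ... | no t≮p′ = inj₂ (case-equal λ s s<p′ → eqs s (<-≤-trans s<p′ (≮⇒≥ t≮p′)))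


-- Words and their factors

module _ {a} {A : Set a} where

  take-+ : ∀ ℓ m (w : List A) → take (ℓ + m) w ≡ take ℓ w ++ take m (drop ℓ w)
  take-+ zero    m w       = refl
  take-+ (suc ℓ) zero []   = refl
  take-+ (suc ℓ) (suc m) [] = refl
  take-+ (suc ℓ) m (x ∷ w) = cong (x ∷_) (take-+ ℓ m w)

  0<length : ∀ {w : List A} → w ≢ [] → 0 < length w
  0<length {[]}    w≢[] = ⊥-elim (w≢[] refl)
  0<length {_ ∷ _} _    = z<s

  length>0⇒≢[] : ∀ {w : List A} → 0 < length w → w ≢ []
  length>0⇒≢[] () refl

  -- Indexing with a default value keeps bounds out of the terms, so that positions can be computed
  -- with as plain numbers.
  nth : A → List A → ℕ → A
  nth d []      _       = d
  nth d (x ∷ w) zero    = x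
  nth d (x ∷ w) (suc k) = nth d w k

  lookup≡nth : ∀ d (w : List A) i → lookup w i ≡ nth d w (toℕ i)
  lookup≡nth d (x ∷ w) zero    = refl
  lookup≡nth d (x ∷ w) (suc i) = lookup≡nth d w i

  nth-++ˡ : ∀ d (u v : List A) {k} → k < length u → nth d (u ++ v) k ≡ nth d u k
  nth-++ˡ d (x ∷ u) v {zero}  _  = refl
  nth-++ˡ d (x ∷ u) v {suc k} lt = nth-++ˡ d u v (s<s⁻¹ lt)

  nth-++ʳ : ∀ d (u v : List A) k → nth d (u ++ v) (length u + k) ≡ nth d v k
  nth-++ʳ d []      v k = refl
  nth-++ʳ d (x ∷ u) v k = nth-++ʳ d u v k

  nth-take : ∀ d ℓ (w : List A) {k} → k < ℓ → nth d (take ℓ w) k ≡ nth d w k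
  nth-take d (suc ℓ) []      _          = refl
  nth-take d (suc ℓ) (x ∷ w) {zero}  _  = refl
  nth-take d (suc ℓ) (x ∷ w) {suc k} lt = nth-take d ℓ w (s<s⁻¹ lt)

  nth-drop : ∀ d s (w : List A) k → nth d (drop s w) k ≡ nth d w (s + k)
  nth-drop d zero    w       k = refl
  nth-drop d (suc s) []      k = refl
  nth-drop d (suc s) (x ∷ w) k = nth-drop d s w k

  drop-nth : ∀ d s (w : List A) → s < length w → drop s w ≡ nth d w s ∷ drop (suc s) w
  drop-nth d zero    (x ∷ w) _  = refl
  drop-nth d (suc s) (x ∷ w) lt = drop-nth d s w (s<s⁻¹ lt)

module LyndonWords {c ℓ₁ ℓ₂} (alphabet : StrictTotalOrder c ℓ₁ ℓ₂) where

  open LyndonTrees alphabet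
  private
    module A = StrictTotalOrder alphabet
    module ≈ = A.Eq

  module _ (d : Letter) where

    Mismatch : Word → Word → ℕ → Set (ℓ₁ ⊔ ℓ₂)
    Mismatch u v t =
      t < length u × t < length v × (∀ z → z < t → nth d u z ≈ nth d v z) × nth d u t <ᴬ nth d v t

    -- The length condition excludes that `u` is a proper prefix of `v`; what remains is a differing
    -- letter.
    <ˡᵉˣ⇒mismatch : ∀ {u v} → length v ≤ length u → u <ˡᵉˣ v → ∃ (Mismatch u v)
    <ˡᵉˣ⇒mismatch le (this x<y) = 0 , z<s , z<s , (λ _ ()) , x<y
    <ˡᵉˣ⇒mismatch le (next x≈y u<v) with <ˡᵉˣ⇒mismatch (s≤s⁻¹ le) u<v
    ... | t , t<u , t<v , eqs , lt =
      suc t , s<s t<u , s<s t<v , (λ { zero _ → x≈y ; (suc z) z<t → eqs z (s<s⁻¹ z<t) }) , lt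

    mismatch⇒<ˡᵉˣ : ∀ {u v} t → Mismatch u v t → u <ˡᵉˣ v
    mismatch⇒<ˡᵉˣ {x ∷ u} {y ∷ v} zero    (_ , _ , _ , lt) = this lt
    mismatch⇒<ˡᵉˣ {x ∷ u} {y ∷ v} (suc t) (t<u , t<v , eqs , lt) =
      next (eqs 0 z<s) (mismatch⇒<ˡᵉˣ t
        (s<s⁻¹ t<u , s<s⁻¹ t<v , (λ z z<t → eqs (suc z) (s<s z<t)) , lt))

  module Factors (d : Letter) (y : Word) (lyndon-y : Lyndon y) where

    n : ℕ
    n = length y

    Y : ℕ → Letter
    Y = nth d y

    open LyndonSequence alphabet Y public

    -- This is the form in which the Lyndon property enters all arguments on positions: a proper
    -- suffix is shorter than the word, so it exceeds the word at a letter of its own.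
    excess : ∀ r → 0 < r → r < n → ∃ λ t → r + t < n × FirstExcess r t
    excess r 0<r r<n with <ˡᵉˣ⇒mismatch d (≤-trans (≤-reflexive (length-drop r y)) (m∸n≤m n r))
      (proj₂ lyndon-y (take r y) (drop r y)
        (length>0⇒≢[] (subst (0 <_) (sym (length-take r y)) (⊓-glb 0<r (≤-<-trans z≤n r<n))))
        (length>0⇒≢[] (subst (0 <_) (sym (length-drop r y)) (m<n⇒0<n∸m r<n)))
        (sym (take++drop≡id r y)))
    ... | t , _ , t<v , eqs , lt =
      t , m<n∸o⇒o+m<n , (λ s s<t → ≈.sym (≈.trans (eqs s s<t) (≈.reflexive (nth-drop d r y s))))
        , subst (Y t <ᴬ_) (nth-drop d r y t) lt
      where
      m<n∸o⇒o+m<n : r + t < n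
      m<n∸o⇒o+m<n = subst (r + t <_) (m+[n∸m]≡n (<⇒≤ r<n))
        (+-monoʳ-< r (subst (t <_) (length-drop r y) t<v))

    open Lyndonian n excess public

    factor : ℕ → ℕ → Word
    factor s ℓ = take ℓ (drop s y)

    length-factor : ∀ s ℓ → s + ℓ ≤ n → length (factor s ℓ) ≡ ℓ
    length-factor s ℓ le = trans (length-take ℓ (drop s y)) (m≤n⇒m⊓n≡m
      (subst (ℓ ≤_) (sym (length-drop s y)) (m+n≤o⇒m≤o∸n ℓ (subst (_≤ n) (+-comm s ℓ) le))))

    nth-factor : ∀ s ℓ {k} → k < ℓ → nth d (factor s ℓ) k ≡ Y (s + k)
    nth-factor s ℓ {k} k<ℓ = trans (nth-take d ℓ (drop s y) k<ℓ) (nth-drop d s y k)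

    factor-++ : ∀ s ℓ m → factor s (ℓ + m) ≡ factor s ℓ ++ factor (s + ℓ) m
    factor-++ s ℓ m = trans (take-+ ℓ m (drop s y))
      (cong (λ w → factor s ℓ ++ take m w) (drop-drop s ℓ y))

    factor-[] : ∀ s → s < n → factor s 1 ≡ [ Y s ]
    factor-[] s s<n = cong (take 1) (drop-nth d s y s<n)

    factor-all : factor 0 n ≡ y
    factor-all = take-all n y ≤-refl

    -- The factor is an unbordered prefix of y, up to ≈.
    shortestBorder⇒lyndon : ∀ a ℓ k → k < n → a + ℓ ≡ suc k → ShortestBorder a k →
      Lyndon (factor a ℓ)
    shortestBorder⇒lyndon a ℓ k k<n a+ℓ≡ sb = length>0⇒≢[] (subst (0 <_) (sym len) 0<ℓ) , smaller
      where
      len : length (factor a ℓ) ≡ ℓ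
      len = length-factor a ℓ (subst (_≤ n) (sym a+ℓ≡) k<n)
      0<ℓ : 0 < ℓ
      0<ℓ = +-cancelˡ-< a _ _ (subst₂ _<_ (sym (+-identityʳ a)) (sym a+ℓ≡) (s≤s (proj₁ sb)))
      smaller : ∀ u v → u ≢ [] → v ≢ [] → factor a ℓ ≡ u ++ v → factor a ℓ <ˡᵉˣ v
      smaller u v u≢[] v≢[] eq = from-excess
        (shortestBorder⇒excess a k k<n sb r (0<length u≢[]) ar≤k)
        where
        r = length u
        r+v≡ℓ : r + length v ≡ ℓ
        r+v≡ℓ = trans (sym (length-++ u)) (trans (cong length (sym eq)) len)
        arv≡ : (a + r) + length v ≡ suc k
        arv≡ = trans (+-assoc a r _) (trans (cong (a +_) r+v≡ℓ) a+ℓ≡)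
        ar≤k : a + r ≤ k
        ar≤k = s≤s⁻¹ (subst (a + r <_) arv≡ (m<m+n (a + r) (0<length v≢[])))
        nth-v : ∀ z → r + z < ℓ → nth d v z ≡ Y ((a + r) + z)
        nth-v z lt = trans (sym (nth-++ʳ d u v z)) (trans (cong (λ w → nth d w (r + z)) (sym eq))
          (trans (nth-factor a ℓ lt) (cong Y (sym (+-assoc a r z)))))
        from-excess : ∃ (λ t → (a + r) + t ≤ k × (∀ z → z < t → Y (a + z) ≈ Y ((a + r) + z))
          × Y (a + t) <ᴬ Y ((a + r) + t)) → factor a ℓ <ˡᵉˣ v
        from-excess (t , art≤k , eqs , lt) = mismatch⇒<ˡᵉˣ d t
          ( subst (t <_) (sym len) (t<ℓ t ≤-refl) , t<v
          , (λ z z<t → subst₂ _≈_ (sym (nth-factor a ℓ (t<ℓ z (<⇒≤ z<t))))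
                         (sym (nth-v z (rt<ℓ z (<⇒≤ z<t)))) (eqs z z<t))
          , subst₂ _<ᴬ_ (sym (nth-factor a ℓ (t<ℓ t ≤-refl))) (sym (nth-v t (rt<ℓ t ≤-refl))) lt)
          where
          t<v : t < length v
          t<v = +-cancelˡ-< (a + r) _ _ (subst ((a + r) + t <_) (sym arv≡) (s≤s art≤k))
          rt<ℓ : ∀ z → z ≤ t → r + z < ℓ
          rt<ℓ z z≤t = subst (r + z <_) r+v≡ℓ (+-monoʳ-< r (≤-<-trans z≤t t<v))
          t<ℓ : ∀ z → z ≤ t → z < ℓ
          t<ℓ z z≤t = ≤-<-trans (m≤n+m z r) (rt<ℓ z z≤t)

    -- A longer proper prefix ends inside the agreement of the suffix at a + ℓ₁, so it
    -- has a proper suffix that is a prefix of y and is therefore not larger.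
    agree⇒longestLyndonPrefix : ∀ a ℓ₁ ℓ₂ j → j < n → (a + ℓ₁) + ℓ₂ ≡ suc j → 0 < ℓ₂ →
      Lyndon (factor a ℓ₁) → Agree (a + ℓ₁) j →
      LongestLyndonPrefix (factor a ℓ₁) (factor (a + ℓ₁) ℓ₂)
    agree⇒longestLyndonPrefix a ℓ₁ ℓ₂ j j<n tot 0<ℓ₂ lyn ag =
      lyn , length>0⇒≢[] (subst (0 <_) (sym (length-factor (a + ℓ₁) ℓ₂ (subst (_≤ n) (sym tot) j<n))) 0<ℓ₂)
          , λ u v v≢[] eq lyn-u → ≮⇒≥ λ lt → ¬longer u v v≢[] (trans (factor-++ a ℓ₁ ℓ₂) eq) lyn-u
              (subst (_< length u) len₁ lt)
      where
      len₁ : length (factor a ℓ₁) ≡ ℓ₁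
      len₁ = length-factor a ℓ₁ (≤-trans (m≤m+n (a + ℓ₁) ℓ₂) (subst (_≤ n) (sym tot) j<n))
      len : length (factor a (ℓ₁ + ℓ₂)) ≡ ℓ₁ + ℓ₂
      len = length-factor a (ℓ₁ + ℓ₂) (subst (_≤ n) (trans (sym tot) (+-assoc a ℓ₁ ℓ₂)) j<n)
      ¬longer : ∀ u v → v ≢ [] → factor a (ℓ₁ + ℓ₂) ≡ u ++ v → Lyndon u → ¬ ℓ₁ < length u
      ¬longer u v v≢[] eq lyn-u ℓ₁<u with <ˡᵉˣ⇒mismatch d
        (≤-trans (≤-reflexive (length-drop ℓ₁ u)) (m∸n≤m (length u) ℓ₁))
        (proj₂ lyn-u (take ℓ₁ u) (drop ℓ₁ u)
          (length>0⇒≢[] (subst (0 <_) (sym (length-take ℓ₁ u))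
            (⊓-glb (subst (0 <_) len₁ (0<length (proj₁ lyn))) (≤-<-trans z≤n ℓ₁<u))))
          (length>0⇒≢[] (subst (0 <_) (sym (length-drop ℓ₁ u)) (m<n⇒0<n∸m ℓ₁<u)))
          (sym (take++drop≡id ℓ₁ u)))
      ... | t , t<u , t<v , eqs , lt = agree⇒¬excess a (a + ℓ₁) j (m≤m+n a ℓ₁) (<⇒≤ j<n) ag t
            (s≤s⁻¹ (subst (suc ((a + ℓ₁) + t) <_) tot
              (subst₂ _<_ (cong suc (sym (+-assoc a ℓ₁ t))) (sym (+-assoc a ℓ₁ ℓ₂))
                (subst (_< a + (ℓ₁ + ℓ₂)) (+-suc a (ℓ₁ + t)) (+-monoʳ-< a (≤-<-trans ℓ₁+t<u u<ℓ))))))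
            (λ z z<t → subst₂ _≈_ (nth-u z (<-trans z<t t<u))
              (nth-u′ z (<-trans (+-monoʳ-< ℓ₁ z<t) ℓ₁+t<u)) (eqs z z<t))
            (subst₂ _<ᴬ_ (nth-u t t<u) (nth-u′ t ℓ₁+t<u) lt)
        where
        ℓ₁+t<u : ℓ₁ + t < length u
        ℓ₁+t<u = subst (ℓ₁ + t <_) (m+[n∸m]≡n (<⇒≤ ℓ₁<u))
          (+-monoʳ-< ℓ₁ (subst (t <_) (length-drop ℓ₁ u) t<v))
        u<ℓ : length u < ℓ₁ + ℓ₂
        u<ℓ = subst (length u <_) (trans (sym (length-++ u)) (trans (cong length (sym eq)) len))
          (m<m+n (length u) (0<length v≢[]))
        nth-u : ∀ z → z < length u → nth d u z ≡ Y (a + z)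
        nth-u z z<u = trans (sym (nth-++ˡ d u v z<u)) (trans (cong (λ w → nth d w z) (sym eq))
          (nth-factor a (ℓ₁ + ℓ₂) (<-trans z<u u<ℓ)))
        nth-u′ : ∀ z → ℓ₁ + z < length u → nth d (drop ℓ₁ u) z ≡ Y ((a + ℓ₁) + z)
        nth-u′ z lt = trans (nth-drop d ℓ₁ u z) (trans (nth-u (ℓ₁ + z) lt) (cong Y (sym (+-assoc a ℓ₁ z))))

  -- Infinite powers of prefixes

  module _ (x : Letter) (w : Word) (lyndon-xw : Lyndon (x ∷ w)) where

    open Factors x (x ∷ w) lyndon-xw

    private
      length-prefix : ∀ {m} → m < n → length (take m w) ≡ m
      length-prefix {m} m<n = trans (length-take m w) (m≤n⇒m⊓n≡m (s≤s⁻¹ m<n))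

      power≡repeat : ∀ {m} → m < n → ∀ k → ((x ∷ take m w) ^∞) k ≡ repeat m k
      power≡repeat {m} m<n k =
        trans (lookup≡nth x (x ∷ take m w) (k mod suc (length (take m w))))
        (trans (cong (nth x (x ∷ take m w))
          (trans (toℕ-fromℕ< (m%n<n k (suc (length (take m w)))))
            (cong (λ z → k % suc z) (length-prefix m<n))))
        (nth-take x (suc m) (x ∷ w) (m%n<n k (suc m))))

    -- Equal powers can occur only for breaks at the same `j`; there the decreasing splits put the
    -- longer prefix first, as the tie-break of `≺` requires.
    breaks⇒≺ : ∀ {m m′ j j′} → Breaks m j → Breaks m′ j′ → j < j′ ⊎ (j ≡ j′ × m′ < m) →
      prefixUpTo (x ∷ w) m ≺ prefixUpTo (x ∷ w) m′
    breaks⇒≺ {m} {m′} b@(m<j , j<n , _) b′@(m′<j′ , j′<n , _) = λ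
      { (inj₁ j<j′) → less (to-<∞ (repeat-order-< b b′ j<j′))
      ; (inj₂ (refl , m′<m)) → case-≡ m′<m (repeat-order-≡ b b′ m′<m)
      }
      where
      m<n = <-trans m<j j<n
      m′<n = <-trans m′<j′ j′<n
      to-<∞ : repeat m <∞ repeat m′ → ((x ∷ take m w) ^∞) <∞ ((x ∷ take m′ w) ^∞)
      to-<∞ (k , eqs , lt) = k
        , (λ z z<k → subst₂ _≈_ (sym (power≡repeat m<n z)) (sym (power≡repeat m′<n z)) (eqs z z<k))
        , subst₂ _<ᴬ_ (sym (power≡repeat m<n k)) (sym (power≡repeat m′<n k)) lt
      case-≡ : m′ < m → repeat m <∞ repeat m′ ⊎ repeat m ≈∞ repeat m′ →
        prefixUpTo (x ∷ w) m ≺ prefixUpTo (x ∷ w) m′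
      case-≡ m′<m (inj₁ lt) = less (to-<∞ lt)
      case-≡ m′<m (inj₂ eq) = longer
        (λ k → subst₂ _≈_ (sym (power≡repeat m<n k)) (sym (power≡repeat m′<n k)) (eq k))
        (s<s (subst₂ _<_ (sym (length-prefix m′<n)) (sym (length-prefix m<n)) m′<m))

-- Trees and the creation log

module _ {a r} {A : Set a} {R : A → A → Set r} where

  allPairs-lookup : ∀ {xs} → AllPairs R xs → ∀ (i j : Fin (length xs)) → i <ᶠ j →
    R (lookup xs i) (lookup xs j)
  allPairs-lookup (px ∷ _)  zero    (suc j) _  = All.lookup px (∈-lookup j)
  allPairs-lookup (_ ∷ pxs) (suc i) (suc j) lt = allPairs-lookup pxs i j (s<s⁻¹ lt)

  allPairs-connected : ∀ {xs x y} → AllPairs R xs → x ∈ xs → y ∈ xs → x ≡ y ⊎ R x y ⊎ R y x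
  allPairs-connected (_ ∷ _)   (here refl) (here refl) = inj₁ refl
  allPairs-connected (px ∷ _)  (here refl) (there y∈)  = inj₂ (inj₁ (All.lookup px y∈))
  allPairs-connected (px ∷ _)  (there x∈)  (here refl) = inj₂ (inj₂ (All.lookup px x∈))
  allPairs-connected (_ ∷ pxs) (there x∈)  (there y∈)  = allPairs-connected pxs x∈ y∈

  allPairs-map-∈ : ∀ {s} {S : A → A → Set s} {xs} →
    (∀ {x y} → x ∈ xs → y ∈ xs → R x y → S x y) → AllPairs R xs → AllPairs S xs
  allPairs-map-∈ f []         = []
  allPairs-map-∈ f (px ∷ pxs) =
    All.tabulate (λ y∈ → f (here refl) (there y∈) (All.lookup px y∈))
      ∷ allPairs-map-∈ (λ x∈ y∈ → f (there x∈) (there y∈)) pxs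

pointwise-map : ∀ {a b c r} {A : Set a} {B : Set b} {C : Set c} {R : B → C → Set r}
  {f : A → B} {g : A → C} {xs} → All (λ x → R (f x) (g x)) xs → Pointwise R (map f xs) (map g xs)
pointwise-map []         = []
pointwise-map (rx ∷ rxs) = rx ∷ pointwise-map rxs

unique-set⇒↭ : ∀ {a} {A : Set a} {xs ys : List A} → Unique xs → Unique ys →
  (∀ {x} → x ∈ xs → x ∈ ys) → (∀ {x} → x ∈ ys → x ∈ xs) → xs ↭ ys
unique-set⇒↭ uxs uys f g = ∼bag⇒↭ (unique∧set⇒bag uxs uys (mk⇔ f g))

update-same : ∀ (f : Array) k v → (f [ k ≔ v ]) k ≡ v
update-same f k v rewrite dec-true (k ≟ k) refl = refl

update-other : ∀ (f : Array) {k m} v → m ≢ k → (f [ k ≔ v ]) m ≡ f m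
update-other f {k} {m} v m≢k rewrite dec-false (m ≟ k) m≢k = refl

infix-node : ∀ (L : Tree ℕ ℕ) q R → Infix.toList (node L q R) ≡ Infix.toList L ++ q ∷ Infix.toList R
infix-node L q R = go L (q ∷ Infix.toList R)
  where
  go : ∀ (T : Tree ℕ ℕ) xs → Infix.toDiffList T xs ≡ Infix.toList T ++ xs
  go (leaf _)     xs = refl
  go (node L q R) xs = trans (go L (q ∷ Infix.toDiffList R xs))
    (trans (cong (λ zs → Infix.toList L ++ q ∷ zs) (go R xs))
      (trans (sym (++-assoc (Infix.toList L) (q ∷ Infix.toList R) xs))
        (cong (_++ xs) (sym (go L (q ∷ Infix.toList R))))))

-- Ghost state: split m created at time j says that the node with left subtree ending
-- at position m is created in round j of the for loop.
record Entry : Set where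
  constructor entry
  field ident split time : ℕ

open Entry

-- The second component is the hypothesis of `breaks⇒≺`; the first makes identifiers in a sorted log
-- distinct.
_⊏_ : Entry → Entry → Set
e ⊏ e′ = ident e < ident e′ × (time e < time e′ ⊎ (time e ≡ time e′ × split e′ < split e))

Recorded : List Entry → ℕ → ℕ → Set
Recorded log q m = ∃ λ j → entry q m j ∈ log

-- `IsLLT` ignores labels; this relation ties each label to its split through the log.
data Spans (log : List Entry) : ℕ → ℕ → Tree ℕ ℕ → Set where
  leaf : ∀ {p} → Spans log p p (leaf p)
  node : ∀ {s m e q L R} → Recorded log q m → Spans log s m L → Spans log (suc m) e R →
         Spans log s e (node L q R)

unfolds-mono : ∀ {n h h′ q T} → (∀ {x} → x ∈ h → x ∈ h′) → Unfolds n h q T → Unfolds n h′ q T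
unfolds-mono sub (leaf p<n)    = leaf p<n
unfolds-mono sub (node ∈h l r) = node (sub ∈h) (unfolds-mono sub l) (unfolds-mono sub r)

spans-mono : ∀ {log log′ s e T} → (∀ {x} → x ∈ log → x ∈ log′) → Spans log s e T → Spans log′ s e T
spans-mono sub leaf                  = leaf
spans-mono sub (node (j , ∈log) l r) = node (j , sub ∈log) (spans-mono sub l) (spans-mono sub r)

module _ {log : List Entry} where

  spans-≤ : ∀ {s e T} → Spans log s e T → s ≤ e
  spans-≤ leaf         = ≤-refl
  spans-≤ (node _ l r) = ≤-trans (spans-≤ l) (≤-trans (n≤1+n _) (spans-≤ r))

  spans-rightmost : ∀ {s e T} → Spans log s e T → rightmostLeaf T ≡ e
  spans-rightmost leaf         = refl
  spans-rightmost (node _ _ r) = spans-rightmost r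

  spans-recorded : ∀ {s e T q m} → Spans log s e T → SplitsAt T q m → Recorded log q m
  spans-recorded (node {q = q} rec l r) here = subst (Recorded log q) (sym (spans-rightmost l)) rec
  spans-recorded (node rec l r) (inLeft at)  = spans-recorded l at
  spans-recorded (node rec l r) (inRight at) = spans-recorded r at

  spans-covers : ∀ {s e T} → Spans log s e T → ∀ m → s ≤ m → m < e →
    ∃ λ q → q ∈ Infix.toList T × SplitsAt T q m
  spans-covers leaf m s≤m m<e = ⊥-elim (<-irrefl refl (≤-<-trans s≤m m<e))
  spans-covers (node {m = m₀} {q = q} {L} {R} rec l r) m s≤m m<e
    rewrite infix-node L q R with <-cmp m m₀
  ... | tri< m<m₀ _ _ = let q′ , q′∈ , at = spans-covers l m s≤m m<m₀ in
    q′ , ∈-++⁺ˡ q′∈ , inLeft at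
  ... | tri≈ _ refl _ = q , ∈-++⁺ʳ (Infix.toList L) (here refl)
    , subst (SplitsAt (node L q R) q) (spans-rightmost l) here
  ... | tri> _ _ m₀<m = let q′ , q′∈ , at = spans-covers r m m₀<m m<e in
    q′ , ∈-++⁺ʳ (Infix.toList L) (there q′∈) , inRight at

  spans-labels : ∀ {s e T q} → Spans log s e T → q ∈ Infix.toList T →
    ∃ λ m → s ≤ m × m < e × Recorded log q m
  spans-labels {q = q} (node {m = m₀} {q = q₀} {L} {R} rec l r) q∈
    with ∈-++⁻ (Infix.toList L) (subst (q ∈_) (infix-node L q₀ R) q∈)
  ... | inj₁ q∈L = let m , s≤m , m<m₀ , rec′ = spans-labels l q∈L in
    m , s≤m , <-≤-trans m<m₀ (<⇒≤ (spans-≤ r)) , rec′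
  ... | inj₂ (here refl) = m₀ , spans-≤ l , spans-≤ r , rec
  ... | inj₂ (there q∈R) = let m , m₀<m , m<e , rec′ = spans-labels r q∈R in
    m , ≤-trans (spans-≤ l) (<⇒≤ m₀<m) , m<e , rec′

  -- Splits in the left subtree lie below the split of the root, those in the right subtree above
  -- it, and a label has only one split.
  spans-unique : (∀ {q m m′} → Recorded log q m → Recorded log q m′ → m ≡ m′) →
    ∀ {s e T} → Spans log s e T → Unique (Infix.toList T)
  spans-unique functional leaf = []
  spans-unique functional (node {m = m₀} {q = q₀} {L} {R} rec l r) =
    subst Unique (sym (infix-node L q₀ R)) (AllPairs.++⁺ (spans-unique functional l)
      (All.tabulate root≢right ∷ spans-unique functional r)
      (All.tabulate λ q∈L → left≢root q∈L ∷ All.tabulate (left≢right q∈L)))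
    where
    left≢right : ∀ {q q′} → q ∈ Infix.toList L → q′ ∈ Infix.toList R → q ≢ q′
    left≢right q∈L q∈R refl with spans-labels l q∈L | spans-labels r q∈R
    ... | m , _ , m<m₀ , rec₁ | m′ , m₀<m′ , _ , rec₂ =
      <-irrefl (functional rec₁ rec₂) (<-trans m<m₀ m₀<m′)
    left≢root : ∀ {q} → q ∈ Infix.toList L → q ≢ q₀
    left≢root q∈L refl with spans-labels l q∈L
    ... | m , _ , m<m₀ , rec₁ = <-irrefl (functional rec₁ rec) m<m₀
    root≢right : ∀ {q} → q ∈ Infix.toList R → q₀ ≢ q
    root≢right q∈R refl with spans-labels r q∈R
    ... | m , m₀<m , _ , rec₁ = <-irrefl (functional rec rec₁) m₀<m

-- The algorithm

module Determinism {c ℓ₁ ℓ₂} (alphabet : StrictTotalOrder c ℓ₁ ℓ₂) where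

  open LyndonTrees alphabet

  module _ {y : Word} where

    conditional-deterministic : ∀ {j σ τ τ′} → Conditional y j σ τ → Conditional y j σ τ′ → τ ≡ τ′
    conditional-deterministic (then-branch _ _ _)   (then-branch _ _ _)   = refl
    conditional-deterministic (then-branch _ _ neq) (else-branch _ _ eq)  = ⊥-elim (neq eq)
    conditional-deterministic (else-branch _ _ eq)  (then-branch _ _ neq) = ⊥-elim (neq eq)
    conditional-deterministic (else-branch _ _ _)   (else-branch _ _ _)   = refl

    while-deterministic : ∀ {j ℓ k σ τ τ′} → While y j ℓ k σ τ → While y j ℓ k σ τ′ → τ ≡ τ′
    while-deterministic (exit _)       (exit _)       = refl
    while-deterministic (exit ¬lt)     (iterate lt _) = ⊥-elim (¬lt lt)
    while-deterministic (iterate lt _) (exit ¬lt)     = ⊥-elim (¬lt lt)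
    while-deterministic (iterate _ w)  (iterate _ w′) = while-deterministic w w′

    -- With this, the invariant of a single constructed run speaks about every run.
    for-deterministic : ∀ {j σ τ τ′} → For y j σ τ → For y j σ τ′ → τ ≡ τ′
    for-deterministic (exit _)           (exit _)           = refl
    for-deterministic (exit ¬lt)         (iterate lt _ _ _) = ⊥-elim (¬lt lt)
    for-deterministic (iterate lt _ _ _) (exit ¬lt)         = ⊥-elim (¬lt lt)
    for-deterministic (iterate _ c w f)  (iterate _ c′ w′ f′)
      with conditional-deterministic c c′
    ... | refl with while-deterministic w w′
    ... | refl = for-deterministic f f′

-- Invariants of the two loops

module Correctness {c ℓ₁ ℓ₂} (alphabet : StrictTotalOrder c ℓ₁ ℓ₂) where

  open LyndonTrees alphabet
  open LyndonWords alphabet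
  private
    module A = StrictTotalOrder alphabet
    module ≈ = A.Eq

  module Algorithm (x : Letter) (w : Word) (lyndon-y : Lyndon (x ∷ w)) where

    y : Word
    y = x ∷ w

    open Factors x y lyndon-y

    record Built (log : List Entry) (h : List Node) (a k ℓ r : ℕ) : Set (c ⊔ ℓ₁ ⊔ ℓ₂) where
      constructor built
      field
        total   : a + ℓ ≡ suc k
        {tree}  : Tree ℕ ℕ
        unfolds : Unfolds n h r tree
        isLLT   : IsLLT a (factor a ℓ) tree
        spans   : Spans log a k tree

    built-mono : ∀ {log log′ h h′ a k ℓ r} → (∀ {x} → x ∈ log → x ∈ log′) →
      (∀ {x} → x ∈ h → x ∈ h′) → Built log h a k ℓ r → Built log′ h′ a k ℓ r
    built-mono sub sub′ (built tot u l s) = built tot (unfolds-mono sub′ u) l (spans-mono sub s)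

    built-leaf : ∀ {log h} j → j < n → Built log h j j 1 j
    built-leaf j j<n = built (+-comm j 1) (leaf j<n)
      (subst (λ u → IsLLT j u (leaf j)) (sym (factor-[] j j<n)) leaf) leaf

    -- The left factor is Lyndon because it starts at the shortest border of Y 0 ... Y k, and it is
    -- the longest such prefix because the suffix after it agrees up to `j`. The sum `ℓ₂ + ℓ₁`
    -- follows the update of ℓ in the loop.
    built-node : ∀ {log h a k j ℓ₁ ℓ₂ l r q} → j < n → ShortestBorder a k → Agree (suc k) j →
      mkNode q l r ∈ h → Recorded log q k →
      Built log h a k ℓ₁ l → Built log h (suc k) j ℓ₂ r → Built log h a j (ℓ₂ + ℓ₁) q
    built-node {log} {h} {a} {k} {j} {ℓ₁} {ℓ₂} {q = q} j<n sb ag q∈h rec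
      (built tot {L} uL lL sL) (built tot′ {R} uR lR sR) =
      built (trans (cong (_+_ a) (+-comm ℓ₂ ℓ₁)) tot″) (node q∈h uL uR)
        (node (trans (cong (factor a) (+-comm ℓ₂ ℓ₁)) (factor-++ a ℓ₁ ℓ₂))
          (agree⇒longestLyndonPrefix a ℓ₁ ℓ₂ j j<n (trans (cong (_+ ℓ₂) tot) tot′) 0<ℓ₂
            (shortestBorder⇒lyndon a ℓ₁ k k<n tot sb) (subst (λ s → Agree s j) (sym tot) ag))
          lL
          (subst (λ s → IsLLT s (factor (a + ℓ₁) ℓ₂) R) (cong (_+_ a) (sym len))
            (subst (λ s → IsLLT s (factor s ℓ₂) R) (sym tot) lR)))
        (node rec sL sR)
      where
      tot″ : a + (ℓ₁ + ℓ₂) ≡ suc j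
      tot″ = trans (sym (+-assoc a ℓ₁ ℓ₂)) (trans (cong (_+ ℓ₂) tot) tot′)
      k<j : k < j
      k<j = spans-≤ sR
      k<n = <-trans k<j j<n
      0<ℓ₂ : 0 < ℓ₂
      0<ℓ₂ = +-cancelˡ-< (suc k) _ _
        (subst₂ _<_ (sym (+-identityʳ (suc k))) (sym tot′) (s<s k<j))
      len : length (factor a ℓ₁) ≡ ℓ₁
      len = length-factor a ℓ₁ (subst (_≤ n) (sym tot) k<n)

    -- The entries left behind by round `k`: the length of the longest Lyndon suffix of Y 0 ... Y k,
    -- and its left Lyndon tree.
    Prior : List Entry → State → ℕ → Set (c ⊔ ℓ₁ ⊔ ℓ₂)
    Prior log σ k = ∃ λ a → ShortestBorder a k × Built log (nodes σ) a k (lyns σ k) (root σ k)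

    record Logged (Bound : Entry → Set) (log : List Entry) (σ : State) : Set (ℓ₁) where
      constructor logged
      field
        created≡ : created σ ≡ map ident log
        sorted   : AllPairs _⊏_ log
        fresh    : All (λ e → ident e < n + length (nodes σ)) log
        breaks   : All (λ e → Breaks (split e) (time e)) log
        bounded  : All Bound log

    -- Here `p` is the smallest period of the first `j` letters, since a smaller one would give a
    -- border of the unbordered prefix of length `p`; `i` is the remainder of `j`.
    record Period (j p i : ℕ) : Set ℓ₁ where
      constructor period
      field
        0<p        : 0 < p
        p≤j        : p ≤ j
        i<p        : i < p
        quotient   : ∃ λ e → j ≡ i + e * p
        periodic   : Agree p j
        unbordered : ∀ s → 0 < s → s < p → ¬ Agree s p

    record ForInvariant (j : ℕ) (log : List Entry) (σ : State) : Set (c ⊔ ℓ₁ ⊔ ℓ₂) where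
      constructor forInvariant
      field
        prior   : ∀ k → k < j → Prior log σ k
        logs    : Logged (λ e → time e < j) log σ
        periods : Period j (per σ) (i σ)

    -- The next split is s - 1, so the bound `s ≤ split e` makes the splits of a round strictly
    -- decrease.
    InProgress : ℕ → ℕ → Entry → Set
    InProgress j s e = time e < j ⊎ (time e ≡ j × s ≤ split e)

    -- s is where the tree under root σ j starts, so the loop variable k is s − 1.
    record WhileInvariant (j a s ℓ : ℕ) (log : List Entry) (σ : State) : Set (c ⊔ ℓ₁ ⊔ ℓ₂) where
      constructor whileInvariant
      field
        s≤j     : s ≤ j
        a≤s     : a ≤ s
        border  : ShortestBorder a j
        total   : a + lyns σ j ≡ suc j
        agree   : Agree s j
        current : Built log (nodes σ) s j ℓ (root σ j)
        prior   : ∀ k → k < j → Prior log σ k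
        logs    : Logged (InProgress j s) log σ
        periods : Period (suc j) (per σ) (i σ)

    -- The loop tests lengths, but `s + ℓ` and `a + lyns σ j` both equal `suc j`; the failing test
    -- means that `s` has reached `a`.
    while-exit : ∀ {j a s ℓ log σ} → ¬ ℓ < lyns σ j → WhileInvariant j a s ℓ log σ →
      ForInvariant (suc j) log σ
    while-exit {j} {a} {s} {ℓ} {log} {σ} ¬lt (whileInvariant s≤j a≤s border total agree current prior
      (logged c≡ sorted fresh breaks bounded) periods) =
      forInvariant prior′ (logged c≡ sorted fresh breaks (All.map (λ {e} → finished {e}) bounded)) periods
      where
      finished : ∀ {e} → InProgress j s e → time e < suc j
      finished (inj₁ t<j)       = <-trans t<j (n<1+n j)
      finished (inj₂ (refl , _)) = n<1+n j
      s≡a : s ≡ a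
      s≡a = ≤-antisym (+-cancelʳ-≤ ℓ s a (subst (_≤ a + ℓ)
        (trans total (sym (Built.total current))) (+-monoʳ-≤ a (≮⇒≥ ¬lt)))) a≤s
      ℓ≡ : ℓ ≡ lyns σ j
      ℓ≡ = +-cancelˡ-≡ a _ _ (trans (cong (_+ ℓ) (sym s≡a)) (trans (Built.total current) (sym total)))
      prior′ : ∀ k → k < suc j → Prior log σ k
      prior′ k k<1+j with k ≟ j
      ... | no k≢j   = prior k (≤∧≢⇒< (s≤s⁻¹ k<1+j) k≢j)
      ... | yes refl = a , border
        , subst₂ (λ s ℓ → Built log (nodes σ) s j ℓ (root σ j)) s≡a ℓ≡ current

    while-step : ∀ {j a k ℓ log σ} → j < n → ℓ < lyns σ j → a ≤ k →
      WhileInvariant j a (suc k) ℓ log σ →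
      ∃ λ a′ → a′ ≤ k × a′ + lyns σ k ≡ suc k × WhileInvariant j a a′ (ℓ + lyns σ k)
        (log ++ [ entry (n + length (nodes σ)) k j ]) (createNode y j k σ)
    while-step {j} {a} {k} {ℓ} {log} {σ} j<n ℓ<lyns a≤k
      (whileInvariant s≤j a≤s border total agree current prior
        (logged c≡ sorted fresh breaks bounded) periods)
      with prior k s≤j
    ... | a′ , sb′@(a′≤k , ag′ , max′) , prev = a′ , a′≤k , Built.total prev , whileInvariant
        (≤-trans a′≤k (<⇒≤ s≤j))
        -- The loop cannot overshoot: if a′ were below `a`, then `a` would start a shorter border of
        -- Y 0 ... Y k.
        (≮⇒≥ λ a′<a → max′ a a′<a a≤k (agree-mono (s≤s (<⇒≤ s≤j)) (proj₁ (proj₂ border))))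
        border total
        -- The suffix at a′ agrees through `k`, the one at `suc k` agrees up to `j`; the two
        -- agreements are joined.
        (agree-extend a′ (lyns σ k) j (<⇒≤ j<n)
          (subst (Agree a′) (sym (Built.total prev)) ag′)
          (subst (λ s → Agree s j) (sym (Built.total prev)) agree))
        (subst (Built log′ h′ a′ j _) (sym (update-same (root σ) j q))
          (built-node j<n sb′ agree (∈-++⁺ʳ (nodes σ) (here refl)) (j , ∈-++⁺ʳ log (here refl))
            (built-mono ∈-++⁺ˡ ∈-++⁺ˡ prev) (built-mono ∈-++⁺ˡ ∈-++⁺ˡ current)))
        (λ k′ k′<j → let b , sb , prev′ = prior k′ k′<j in b , sb
          , subst (Built log′ h′ b k′ _) (sym (update-other (root σ) q (<⇒≢ k′<j)))
              (built-mono ∈-++⁺ˡ ∈-++⁺ˡ prev′))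
        (logged
          (trans (map-++ Node.ident (nodes σ) _) (trans (cong (_++ [ q ]) c≡) (sym (map-++ ident log _))))
          (AllPairs.++⁺ sorted ([] ∷ []) (All.map (_∷ []) (All.zipWith below (fresh , bounded))))
          (All.++⁺ (All.map (λ lt → <-trans lt q<) fresh) (q< ∷ []))
          (All.++⁺ breaks ((s≤j , j<n , agree , ¬agree) ∷ []))
          (All.++⁺ (All.map (λ {e} → weaken {e}) bounded) (inj₂ (refl , a′≤k) ∷ [])))
        periods
      where
      q = n + length (nodes σ)
      log′ = log ++ [ entry q k j ]
      h′ = nodes (createNode y j k σ)
      q< : q < n + length h′
      q< = +-monoʳ-< n (subst (length (nodes σ) <_) (sym (length-++ (nodes σ)))
        (m<m+n (length (nodes σ)) z<s))
      below : ∀ {e} → ident e < q × InProgress j (suc k) e → e ⊏ entry q k j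
      below (lt , inj₁ t<j)         = lt , inj₁ t<j
      below (lt , inj₂ (t≡j , k<m)) = lt , inj₂ (t≡j , k<m)
      weaken : ∀ {e} → InProgress j (suc k) e → InProgress j a′ e
      weaken (inj₁ t<j)         = inj₁ t<j
      weaken (inj₂ (t≡j , k<m)) = inj₂ (t≡j , ≤-trans a′≤k (<⇒≤ k<m))
      -- As `suc k` lies beyond `a`, it starts no border of Y 0 ... Y j, so its agreement ends
      -- exactly at `j`.
      ¬agree : ¬ Agree (suc k) (suc j)
      ¬agree = proj₂ (proj₂ border) (suc k) (s≤s a≤k) s≤j

    -- Subtracting the merged length leaves the loop variable one below the new start, which is -1
    -- when that start is 0.
    ⊖-shift : ∀ {a ℓ k} → a ≤ k → a + ℓ ≡ suc k → k ⊖ ℓ ≡ a ⊖ 1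
    ⊖-shift {a} {zero}  {k} a≤k tot =
      ⊥-elim (<-irrefl (trans (sym (+-identityʳ a)) tot) (s≤s a≤k))
    ⊖-shift {a} {suc ℓ} {k} a≤k tot = trans
      (cong₂ _⊖_ (trans (sym (suc-injective (trans (sym (+-suc a ℓ)) tot))) (+-comm a ℓ)) (+-comm 1 ℓ))
      (+-cancelˡ-⊖ ℓ a 1)

    while-run : ∀ {j a s ℓ log σ} → Acc _<_ s → j < n → WhileInvariant j a s ℓ log σ →
      ∃₂ λ τ log′ → While y j ℓ (s ⊖ 1) σ τ × ForInvariant (suc j) log′ τ
    while-run {j} {a} {s} {ℓ} {log} {σ} (acc rs) j<n inv with ℓ <? lyns σ j
    ... | no ¬lt = σ , log , exit ¬lt , while-exit ¬lt inv
    ... | yes lt = go s refl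
      where
      open WhileInvariant inv
      a<s : a < s
      a<s = +-cancelʳ-< ℓ a s (subst (a + ℓ <_) (trans total (sym (Built.total current)))
        (+-monoʳ-< a lt))
      -- `iterate` needs a nonnegative loop variable; `suc k ⊖ 1` reduces to `+ k`, and `a < s`
      -- excludes zero.
      go : ∀ s′ → s ≡ s′ → ∃₂ λ τ log′ → While y j ℓ (s′ ⊖ 1) σ τ × ForInvariant (suc j) log′ τ
      go zero    refl = ⊥-elim (n≮0 a<s)
      go (suc k) refl with while-step j<n lt (s≤s⁻¹ a<s) inv
      ... | a′ , a′≤k , tot , inv′ =
        let τ , log′ , run , post = while-run (rs (s≤s a′≤k)) j<n inv′
        in τ , log′ , iterate lt (subst (λ z → While y j _ z _ τ) (sym (⊖-shift a′≤k tot)) run) , post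

    letterAt≡ : ∀ j (j<n : j < n) → letterAt y j j<n ≡ Y j
    letterAt≡ j j<n = trans (lookup≡nth x y (fromℕ< j<n)) (cong Y (toℕ-fromℕ< j<n))

    module _ {j p i : ℕ} (j<n : j < n) (per : Period j p i) where

      open Period per

      -- The algorithm compares y[j] with y[i], while borders concern y[j - p]; periodicity
      -- identifies the two letters.
      period-pred : ∃ λ z → p + z ≡ j × Y z ≈ Y i
      period-pred with quotient
      ... | zero , refl = ⊥-elim (<-irrefl refl (<-≤-trans i<p (≤-trans p≤j (≤-reflexive (+-identityʳ i)))))
      ... | suc e , refl = i + e * p , eq
        , agree-periodic periodic e i (subst (i + e * p <_) eq (m<n+m (i + e * p) 0<p))
        where
        eq : p + (i + e * p) ≡ i + suc e * p
        eq = trans (sym (+-assoc p i _)) (trans (cong (_+ e * p) (+-comm p i)) (+-assoc i p _))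

      -- Breaking the period leaves Y 0 ... Y j unbordered, hence both `lyns[j]` and the new period
      -- are `suc j`.
      period-mismatch : Y j ≉ Y i → ShortestBorder 0 j × Period (suc j) (suc j) 0
      period-mismatch neq with period-pred
      ... | z , refl , z≈i = (z≤n , (λ _ _ → ≈.refl) , unb)
          , period z<s ≤-refl z<s (1 , sym (+-identityʳ _))
              (λ t lt → ⊥-elim (<-irrefl refl (≤-<-trans (m≤m+n (suc j) t) lt)))
              (λ s 0<s s<1+j → unb s 0<s (s≤s⁻¹ s<1+j))
        where
        unb = mismatch⇒unbordered p z 0<p j<n periodic
          (λ eq → neq (≈.trans eq z≈i)) unbordered

      period-match : .{{_ : NonZero p}} → Y j ≈ Y i →
        Period (suc j) p (suc i % p) ×
        (∀ {a} → ShortestBorder a i → ∃ λ d → d + i ≡ j × ShortestBorder (d + a) j)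
      period-match eq = period′ , border
        where
        periodic′ : Agree p (suc j)
        periodic′ t lt with p + t <? j
        ... | yes lt′ = periodic t lt′
        ... | no ¬lt with ≤-antisym (s≤s⁻¹ lt) (≮⇒≥ ¬lt) | period-pred
        ... | pt≡j | z , pz≡j , z≈i = ≈.trans (Y≈ pt≡j) (≈.trans eq (≈.trans (≈.sym z≈i)
                (Y≈ (+-cancelˡ-≡ p _ _ (trans pz≡j (sym pt≡j))))))
        period′ : Period (suc j) p (suc i % p)
        period′ = period 0<p (≤-trans p≤j (n≤1+n j)) (m%n<n (suc i) p)
          -- As `i < p`, the summand `suc i / p` is 1 exactly when the index wraps around.
          (let e , j≡ = quotient in suc i / p + e , trans (cong suc j≡)
            (trans (cong (_+ e * p) (m≡m%n+[m/n]*n (suc i) p))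
              (trans (+-assoc (suc i % p) _ _)
                (cong ((suc i % p) +_) (sym (*-distribʳ-+ p (suc i / p) e))))))
          periodic′ unbordered
        border : ∀ {a} → ShortestBorder a i → ∃ λ d → d + i ≡ j × ShortestBorder (d + a) j
        border {a} sb with quotient
        -- The shift is the largest multiple of `p` up to `j`, where Y 0 ... Y i recurs.
        ... | e , j≡ = e * p , sym j≡′ , subst (ShortestBorder (e * p + a)) (sym j≡′)
              (shortestBorder-shift sb λ t lt → ≈.trans (Y≈ (+-comm (e * p) t))
                (agree-periodic periodic′ e t (subst₂ _<_ (+-comm (e * p) t) (cong suc (sym j≡′)) lt)))
          where
          j≡′ : j ≡ e * p + i
          j≡′ = trans j≡ (+-comm i (e * p))

    for-step : ∀ {j log σ} → j < n → ForInvariant j log σ →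
      ∃₂ λ σ₁ τ → ∃ λ log′ → Conditional y j record σ { root = root σ [ j ≔ j ] } σ₁
        × While y j 1 (j ⊖ 1) σ₁ τ × ForInvariant (suc j) log′ τ
    for-step {j} {log} {σ} j<n (forInvariant prior (logged c≡ sorted fresh breaks bounded) periods) =
      body (letterAt y j j<n A.≟ letterAt y (i σ) i<n)
      where
      i<j : i σ < j
      i<j = <-≤-trans (Period.i<p periods) (Period.p≤j periods)
      i<n : i σ < n
      i<n = <-trans i<j j<n

      after : ℕ → ℕ → ℕ → State
      after v p i′ = record σ { root = root σ [ j ≔ j ] ; lyns = lyns σ [ j ≔ v ] ; per = p ; i = i′ }

      start : ∀ {v p i′ a} → a + v ≡ suc j → ShortestBorder a j → Period (suc j) p i′ →
        WhileInvariant j a j 1 log (after v p i′)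
      start {v} {a = a} tot sb per = whileInvariant ≤-refl (proj₁ sb) sb
        (trans (cong (a +_) (update-same (lyns σ) j v)) tot)
        (λ t lt → ⊥-elim (<-irrefl refl (≤-<-trans (m≤m+n j t) lt)))
        (subst (Built log (nodes σ) j j 1) (sym (update-same (root σ) j j)) (built-leaf j j<n))
        (λ k k<j → let b , sb′ , prev = prior k k<j in b , sb′
          , subst₂ (Built log (nodes σ) b k) (sym (update-other (lyns σ) v (<⇒≢ k<j)))
              (sym (update-other (root σ) j (<⇒≢ k<j))) prev)
        (logged c≡ sorted fresh breaks (All.map inj₁ bounded)) per

      body : Dec (letterAt y j j<n ≈ letterAt y (i σ) i<n) → _
      body (no neq) =
        let sb , per = period-mismatch j<n periods
              (λ eq → neq (subst₂ _≈_ (sym (letterAt≡ j j<n)) (sym (letterAt≡ (i σ) i<n)) eq))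
            τ , log′ , run , post = while-run (<-wellFounded j) j<n (start refl sb per)
        in _ , τ , log′ , then-branch j<n i<n neq , run , post
      body (yes eq) =
        let instance p≢0 = >-nonZero (Period.0<p periods)
            per , shift = period-match j<n periods
              (subst₂ _≈_ (letterAt≡ j j<n) (letterAt≡ (i σ) i<n) eq)
            a , sb , prev = prior (i σ) i<j
            d , d+i≡j , sb′ = shift sb
            tot = trans (+-assoc d a _) (trans (cong (d +_) (Built.total prev))
                    (trans (+-suc d (i σ)) (cong suc d+i≡j)))
            τ , log′ , run , post = while-run (<-wellFounded j) j<n (start tot sb′ per)
        in _ , τ , log′ , else-branch j<n i<n eq , run , post

    for-run : ∀ d {j log σ} → d + j ≡ n → ForInvariant j log σ →
      ∃₂ λ τ log′ → For y j σ τ × ForInvariant n log′ τ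
    for-run zero    refl inv = _ , _ , exit (<-irrefl refl) , inv
    for-run (suc d) {j} d+j≡n inv =
      let j<n = subst (j <_) d+j≡n (s≤s (m≤n+m j d))
          _ , _ , _ , cond , loop , inv′ = for-step j<n inv
          τ , log′ , run , post = for-run d (trans (+-suc d j) d+j≡n) inv′
      in τ , log′ , iterate j<n cond loop run , post

    initial-invariant : ∀ lyns₀ root₀ → ForInvariant 1 [] (initial y lyns₀ root₀)
    initial-invariant lyns₀ root₀ = forInvariant
      (λ { zero _ → 0 , (z≤n , (λ _ _ → ≈.refl) , λ s 0<s s≤0 → ⊥-elim (<-irrefl refl (<-≤-trans 0<s s≤0)))
                  , built-leaf 0 z<s
         ; (suc _) (s<s ()) })
      (logged refl [] [] [] [])
      (period z<s ≤-refl z<s (1 , refl)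
        (λ t lt → ⊥-elim (<-irrefl refl (≤-<-trans (m≤m+n 1 t) lt)))
        (λ s 0<s s<1 → ⊥-elim (<-irrefl refl (≤-<-trans 0<s s<1))))

    correct-run : ∀ lyns₀ root₀ → ∃₂ λ σ log → Run y lyns₀ root₀ σ × ForInvariant n log σ
    correct-run lyns₀ root₀ =
      for-run (length w) (+-comm (length w) 1) (initial-invariant lyns₀ root₀)

    -- The final tree against the log

    module Outcome {log : List Entry} {σ : State} (inv : ForInvariant n log σ) where

      open ForInvariant inv
      open Logged logs

      recorded-functional : ∀ {q m m′} → Recorded log q m → Recorded log q m′ → m ≡ m′
      recorded-functional (_ , e∈) (_ , e′∈) with allPairs-connected sorted e∈ e′∈
      ... | inj₁ refl             = refl
      ... | inj₂ (inj₁ (lt , _)) = ⊥-elim (<-irrefl refl lt)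
      ... | inj₂ (inj₂ (lt , _)) = ⊥-elim (<-irrefl refl lt)

      -- The round is determined by the split, so no split is made in two rounds.
      breaks-functional : ∀ {m j j′} → Breaks m j → Breaks m j′ → ¬ j < j′
      breaks-functional (_ , _ , _ , ¬ag) (_ , _ , ag′ , _) j<j′ = ¬ag (agree-mono j<j′ ag′)

      ⊏⇒split≢ : ∀ {e e′} → e ∈ log → e′ ∈ log → e ⊏ e′ → split e ≢ split e′
      ⊏⇒split≢ e∈ e′∈ (_ , inj₁ t<t′) refl =
        breaks-functional (All.lookup breaks e∈) (All.lookup breaks e′∈) t<t′
      ⊏⇒split≢ e∈ e′∈ (_ , inj₂ (_ , lt)) eq = <-irrefl (sym eq) lt

      recorded-injective : ∀ {q q′ m} → Recorded log q m → Recorded log q′ m → q ≡ q′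
      recorded-injective (_ , e∈) (_ , e′∈) with allPairs-connected sorted e∈ e′∈
      ... | inj₁ refl     = refl
      ... | inj₂ (inj₁ r) = ⊥-elim (⊏⇒split≢ e∈ e′∈ r refl)
      ... | inj₂ (inj₂ r) = ⊥-elim (⊏⇒split≢ e′∈ e∈ r refl)

      last-tree : Built log (nodes σ) 0 (length w) n (returned y σ)
      last-tree with prior (length w) ≤-refl
      ... | a , (a≤ , ag , _) , b@(built tot _ _ _) with agree-full⇒zero a (s≤s a≤) ag
      ... | refl = subst (λ ℓ → Built log (nodes σ) 0 (length w) ℓ (root σ (length w))) tot b

      open Built last-tree using (tree; unfolds; spans)

      isLLT : IsLLT 0 y tree
      isLLT = subst (λ u → IsLLT 0 u tree) factor-all (Built.isLLT last-tree)

      split< : ∀ {e} → e ∈ log → split e < length w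
      split< e∈ = let m<j , j<n , _ = All.lookup breaks e∈ in <-≤-trans m<j (s≤s⁻¹ j<n)

      -- No created node is lost: the final tree realises every split, and a split determines its
      -- identifier.
      splitsAt : ∀ {e} → e ∈ log → ident e ∈ Infix.toList tree × SplitsAt tree (ident e) (split e)
      splitsAt {e} e∈ with spans-covers spans (split e) z≤n (split< e∈)
      ... | q , q∈ , at with recorded-injective (spans-recorded spans at) (time e , e∈)
      ... | refl = q∈ , at

      splits↭ : map split log ↭ upTo (length w)
      splits↭ = unique-set⇒↭ (AllPairs.map⁺ (allPairs-map-∈ ⊏⇒split≢ sorted)) (upTo⁺ (length w))
        (λ m∈ → let e , e∈ , m≡ = ∈-map⁻ split m∈ in
          ∈-upTo⁺ (subst (_< length w) (sym m≡) (split< e∈)))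
        (λ {m} m∈ → let q , _ , at = spans-covers spans m z≤n (∈-upTo⁻ m∈)
                        j , e∈ = spans-recorded spans at
                    in ∈-map⁺ split e∈)

      idents↭ : Infix.toList tree ↭ map ident log
      idents↭ = unique-set⇒↭ (spans-unique recorded-functional spans)
        (AllPairs.map⁺ (allPairs-map-∈ (λ _ _ r → <⇒≢ (proj₁ r)) sorted))
        (λ q∈ → let _ , _ , _ , _ , e∈ = spans-labels spans q∈ in ∈-map⁺ ident e∈)
        (λ q∈ → let e , e∈ , q≡ = ∈-map⁻ ident q∈ in
          subst (_∈ Infix.toList tree) (sym q≡) (proj₁ (splitsAt e∈)))

      ⊏⇒≺ : ∀ {e e′} → e ∈ log → e′ ∈ log → e ⊏ e′ →
        prefixUpTo y (split e) ≺ prefixUpTo y (split e′)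
      ⊏⇒≺ e∈ e′∈ r = breaks⇒≺ x w lyndon-y (All.lookup breaks e∈) (All.lookup breaks e′∈) (proj₂ r)

      associated : ∀ {e p} → e ∈ log → AssociatedPrefix y tree (ident e) p → p ≡ prefixUpTo y (split e)
      associated {e} e∈ (m , at , p≡) = trans p≡ (cong (prefixUpTo y)
        (recorded-functional (spans-recorded spans at) (time e , e∈)))

      InOrder : ℕ → ℕ → Set _
      InOrder q q′ = ∀ p p′ → AssociatedPrefix y tree q p → AssociatedPrefix y tree q′ p′ → p ≺ p′

      idents-in-order : AllPairs InOrder (map ident log)
      idents-in-order = AllPairs.map⁺ (allPairs-map-∈ (λ e∈ e′∈ r p p′ as as′ →
        subst₂ _≺_ (sym (associated e∈ as)) (sym (associated e′∈ as′)) (⊏⇒≺ e∈ e′∈ r)) sorted)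

      prefixes : List Word
      prefixes = map (λ e → prefixUpTo y (split e)) log

      prefixes↭ : prefixes ↭ properPrefixes y
      prefixes↭ = subst (_↭ properPrefixes y) (sym (map-∘ log)) (↭-map⁺ (prefixUpTo y) splits↭)

      outcome : length (created σ) ≡ length y ∸ 1
        × (∃ λ t → Unfolds (length y) (nodes σ) (returned y σ) t
          × IsLLT 0 y t
          × Infix.toList t ↭ created σ
          × (∀ (a b : Fin (length (created σ))) → a <ᶠ b →
              ∀ p p′ → AssociatedPrefix y t (lookup (created σ) a) p →
                       AssociatedPrefix y t (lookup (created σ) b) p′ → p ≺ p′)
          × (∃ λ ps → Pointwise (AssociatedPrefix y t) (created σ) ps
              × ps ↭ properPrefixes y
              × AllPairs _≺_ ps))
      outcome rewrite created≡ =
          trans (length-map ident log) (trans (sym (length-map split log))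
            (trans (↭-length splits↭) (length-upTo (length w))))
        , tree , unfolds , isLLT , idents↭ , allPairs-lookup idents-in-order
        , prefixes
        , pointwise-map (All.tabulate λ {e} e∈ → split e , proj₂ (splitsAt e∈) , refl)
        , prefixes↭
        , AllPairs.map⁺ (allPairs-map-∈ ⊏⇒≺ sorted)

theorem6 : ∀ {c ℓ₁ ℓ₂} (alphabet : StrictTotalOrder c ℓ₁ ℓ₂) →
    let open LyndonTrees alphabet in
    ∀ (y : Word) → Lyndon y → 1 < length y →
    ∀ (lyns₀ root₀ : Array) →
    (∃ λ σ → Run y lyns₀ root₀ σ)
    × (∀ σ → Run y lyns₀ root₀ σ →
    length (created σ) ≡ length y ∸ 1
    × (∃ λ t →
    Unfolds (length y) (nodes σ) (returned y σ) t
    × IsLLT 0 y t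
    × Infix.toList t ↭ created σ
    × (∀ (a b : Fin (length (created σ))) → a <ᶠ b →
    ∀ p p′ → AssociatedPrefix y t (lookup (created σ) a) p →
    AssociatedPrefix y t (lookup (created σ) b) p′ →
    p ≺ p′)
    × (∃ λ ps →
    Pointwise (AssociatedPrefix y t) (created σ) ps
    × ps ↭ properPrefixes y
    × AllPairs _≺_ ps)))
theorem6 alphabet []      _        () _ _
theorem6 alphabet (x ∷ w) lyndon-y _ lyns₀ root₀ = (_ , run) , λ τ run′ →
  subst _ (Determinism.for-deterministic alphabet run run′) (Algorithm.Outcome.outcome x w lyndon-y inv)
  where
  open Correctness alphabet
  goodRun = Algorithm.correct-run x w lyndon-y lyns₀ root₀
  run = proj₁ (proj₂ (proj₂ goodRun))
  inv = proj₂ (proj₂ (proj₂ goodRun))
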